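{- For every integer $n>1$, \[ t(n)\ge n-\lceil e\cdot(\ln n+1)\rceil. \]
   Context: A cyclic permutation of order $n$ is a bijective labeling of the vertices of a cycle of length $n$ by the elements of $[n]$, up to rotation of the cycle (reflections are not identified). A swap exchanges the labels of any two (not necessarily adjacent) vertices. $t(n)$ is the maximum, over all cyclic permutations of order $n$, of the minimum number of swaps needed to transform it into the trivial cyclic permutation $(1,2,\ldots,n)$ (labels $1,\ldots,n$ consecutively in order around the cycle). Equivalently, with $c=(1,2,\ldots,n)\in S_n$, $C_n=\langle c\rangle$ and $\operatorname{cyc}(\sigma)$ the number of cycles of $\sigma\in S_n$ (fixed points included), $t(n)=\max_{\pi\in S_n}\min_{\sigma\in\pi C_n}(n-\operatorname{cyc}(\sigma))$. Here $e$ is Euler's number and $\ln$ the natural logarithm. -}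

module Defs where

open import Data.Nat as ℕ using (ℕ; zero; suc; _∸_; _^_; NonZero; _!)
open import Data.Nat.Properties using (m*n≢0; m^n≢0; _!≢0)

open import Data.Nat.DivMod using (_mod_)
open import Data.Integer using (+_)
open import Data.Rational as ℚ using (ℚ; _/_; _≤_)
open import Data.Fin as Fin using (Fin; toℕ)
open import Data.Fin.Properties using (all?)
open import Data.Fin.Permutation using (Permutation′; _⟨$⟩ʳ_)
open import Data.List using (List; length; filter; allFin)
open import Data.Product using (Σ; _×_; ∃)
open import Relation.Nullary using (Dec)

-- Cycle count of a map σ : Fin n → Fin n (used for bijections).
-- A cycle of σ is counted once, via its least element: x is the least
-- element of its cycle iff x ≤ σ^j x for all j < n.

iter : ∀ {n} → (Fin n → Fin n) → ℕ → Fin n → Fin n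
iter σ zero    x = x
iter σ (suc j) x = σ (iter σ j x)

isCycleMin : ∀ {n} → (Fin n → Fin n) → Fin n → Set
isCycleMin {n} σ x = (j : Fin n) → toℕ x ℕ.≤ toℕ (iter σ (toℕ j) x)

isCycleMin? : ∀ {n} (σ : Fin n → Fin n) (x : Fin n) → Dec (isCycleMin σ x)
isCycleMin? σ x = all? (λ j → toℕ x ℕ.≤? toℕ (iter σ (toℕ j) x))

cyc : ∀ {n} → (Fin n → Fin n) → ℕ
cyc {n} σ = length (filter (isCycleMin? σ) (allFin n))

rot : ∀ {n} → ℕ → Fin n → Fin n
rot {zero}  i ()
rot {suc n} i x = (toℕ x ℕ.+ i) mod (suc n)

coset : ∀ {n} → Permutation′ n → ℕ → Fin n → Fin n
coset π i x = π ⟨$⟩ʳ (rot i x)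

-- "t(n) ≥ b", with t(n) = max_π min_{σ ∈ π C_n} (n - cyc σ),
-- unfolded: some π has n - cyc(π c^i) ≥ b for every i < n.
tAtLeast : ℕ → ℕ → Set
tAtLeast n b = ∃ λ (π : Permutation′ n) → (i : Fin n) → b ℕ.≤ n ∸ cyc (coset π (toℕ i))

-- The real number e·(ln n + 1) as the supremum of an increasing sequence
-- of nonnegative rationals  L n m = E m * (1 + ℓ n m),  where
--   E m   = Σ_{j=0}^{m} 1/j!                                   (↑ e)
--   ℓ n m = 2 Σ_{j=0}^{m} z^{2j+1}/(2j+1),  z = (n-1)/(n+1)     (↑ ln n, n ≥ 1)

eApprox : ℕ → ℚ
eApprox zero    = + 1 / (0 !)
  where instance _ = 0 !≢0
eApprox (suc m) = eApprox m ℚ.+ (+ 1 / (suc m !))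
  where instance _ = (suc m) !≢0

lnTerm : ℕ → ℕ → ℚ
lnTerm n j = + (2 ℕ.* (n ∸ 1) ^ k) / (k ℕ.* (suc n) ^ k)
  where
  k = suc (2 ℕ.* j)
  instance _ = m*n≢0 k (suc n ^ k) {{_}} {{m^n≢0 (suc n) k}}

lnApprox : ℕ → ℕ → ℚ
lnApprox n zero    = lnTerm n zero
lnApprox n (suc m) = lnApprox n m ℚ.+ lnTerm n (suc m)

L : ℕ → ℕ → ℚ
L n m = eApprox m ℚ.* (ℚ.1ℚ ℚ.+ lnApprox n m)

UpperEL : ℕ → ℕ → Set
UpperEL n k = (m : ℕ) → L n m ≤ (+ k / 1)

-- k = ⌈ e·(ln n + 1) ⌉ : the least natural number ≥ e·(ln n + 1)
-- (this quantity is positive for n ≥ 1, so its ceiling is a natural number)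
IsCeilEL : ℕ → ℕ → Set
IsCeilEL n k = UpperEL n k × ((k′ : ℕ) → UpperEL n k′ → k ℕ.≤ k′)

{-# OPTIONS --safe #-}
-- Choose π at random and put x = A / B ≥ 1. Removing one point at a time gives
-- E[x ^ cyc (π cⁱ)] = x (x + 1) ⋯ (x + n − 1) / n!, so some π satisfies, with N = n − 1,
--   Σᵢ x ^ cyc (π cⁱ) ≤ x ∏_{j ≤ N} (1 + x / j) ≤ x · exp (x H_N).
-- If some cyc (π cⁱ) exceeded k, the left side would be larger than x ^ (k + 1). With x = k / H_N this
-- requires e H_N > k, which contradicts H_N ≤ ln n + 1 and e (ln n + 1) ≤ k.
-- To stay within ℕ and ℚ, expectations become conditional choices with A = k N!, B = N! H_N, and exp
-- is bounded by powers of 1 + 1 / B, which stay below the partial sums of the series for e.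
module Submission where

open import Defs
open import Data.Nat using (ℕ; zero; suc; _+_; _*_; _∸_; _^_; _≤_; _<_; z≤n; s≤s; s≤s⁻¹; _!; NonZero; >-nonZero)
open import Data.Nat.Properties
open import Data.Nat.DivMod using (_%_; %-distribˡ-+; [m+n]%n≡m%n; m<n⇒m%n≡m; m%n<n; m%n%n≡m%n)
open import Data.Nat.Induction using (<-rec)
open import Data.Nat.Tactic.RingSolver using (solve-∀)
open import Data.Integer as ℤ using (+_)
import Data.Integer.Properties as ℤ
open import Data.Rational as ℚ using (ℚ; _/_; 0ℚ; 1ℚ; toℚᵘ)
import Data.Rational.Properties as ℚ
open import Data.Rational.Unnormalised as ℚᵘ using (mkℚᵘ; *≤*)
import Data.Rational.Unnormalised.Properties as ℚᵘ
open import Data.Fin as Fin using (Fin; zero; suc; toℕ; fromℕ; fromℕ<; punchIn)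
open import Data.Fin.Properties as Fin using (toℕ<n; toℕ-fromℕ<; toℕ-injective; pigeonhole; punchIn-cancel-≤; punchInᵢ≢i)
open import Data.Fin.Permutation using (Permutation′; permutation; _⟨$⟩ʳ_; _∘ₚ_; insert; remove; transpose; insert-punchIn; punchIn-permute) renaming (id to idₚ)
open import Data.List using (_∷_; _∷ʳ_; [_]; _++_; length; filter; tabulate)
open import Data.List.Properties using (filter-++; length-++; filter-reject; length-filter)
open import Data.Bool using (Bool; true; false; if_then_else_)
open import Data.Product using (∃; _×_; _,_)
open import Data.Sum using (inj₁; inj₂)
open import Function using (_∘_; id; Injection)
open import Function.Properties.Inverse using (↔⇒↣)
open import Relation.Nullary using (yes; no; ¬_; contradiction; does)
open import Relation.Unary using (Pred; Decidable)
open import Relation.Binary.PropositionalEquality hiding ([_])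
open import Algebra.Bundles using (module CommutativeMonoid)
open import Algebra.Properties.CommutativeSemigroup (CommutativeMonoid.commutativeSemigroup ℚ.+-0-commutativeMonoid) using (interchange)
open import Algebra.Properties.Semiring.Sum +-*-semiring using (sum; sum-cong-≗; *-distribˡ-sum; *-distribʳ-sum; ∑-comm)

-- Cycle counts

iter-+ : ∀ {n} (σ : Fin n → Fin n) i j x → iter σ (i + j) x ≡ iter σ i (iter σ j x)
iter-+ σ zero    j x = refl
iter-+ σ (suc i) j x = cong σ (iter-+ σ i j x)

-- `isCycleMin` tests only exponents below `n`. An exponent `m ≥ n` can be lowered: by pigeonhole
-- two of the first `n + 1` iterates agree, and cutting out the loop between them leaves a smaller
-- exponent.
orbit-bounded : ∀ {n} (σ : Fin n → Fin n) x m → ∃ λ (j : Fin n) → iter σ m x ≡ iter σ (toℕ j) x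
orbit-bounded {n} σ x = <-rec _ step
  where
  step : ∀ m → (∀ {l} → l < m → ∃ λ (j : Fin n) → iter σ l x ≡ iter σ (toℕ j) x) →
         ∃ λ (j : Fin n) → iter σ m x ≡ iter σ (toℕ j) x
  step m rec with m <? n
  ... | yes m<n = fromℕ< m<n , cong (λ l → iter σ l x) (sym (toℕ-fromℕ< m<n))
  ... | no  m≮n with i , j , i<j , eq ← pigeonhole (n<1+n n) (λ i → iter σ (toℕ i) x) =
    let j≤m = ≤-trans (s≤s⁻¹ (toℕ<n j)) (≮⇒≥ m≮n)
        l , l-eq = rec (subst (m ∸ toℕ j + toℕ i <_) (m∸n+n≡m j≤m) (+-monoʳ-< (m ∸ toℕ j) i<j))
    in l , (begin
      iter σ m x                               ≡⟨ cong (λ l → iter σ l x) (m∸n+n≡m j≤m) ⟨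
      iter σ (m ∸ toℕ j + toℕ j) x             ≡⟨ iter-+ σ (m ∸ toℕ j) (toℕ j) x ⟩
      iter σ (m ∸ toℕ j) (iter σ (toℕ j) x)    ≡⟨ cong (iter σ (m ∸ toℕ j)) eq ⟨
      iter σ (m ∸ toℕ j) (iter σ (toℕ i) x)    ≡⟨ iter-+ σ (m ∸ toℕ j) (toℕ i) x ⟨
      iter σ (m ∸ toℕ j + toℕ i) x             ≡⟨ l-eq ⟩
      iter σ (toℕ l) x                         ∎)
    where open ≡-Reasoning

cycleMin-≤-iter : ∀ {n} (σ : Fin n → Fin n) {x} → isCycleMin σ x → ∀ m → x Fin.≤ iter σ m x
cycleMin-≤-iter σ {x} min m with j , eq ← orbit-bounded σ x m = subst (x Fin.≤_) (sym eq) (min j)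

tabulate-punchIn-last : ∀ {a} {A : Set a} n (f : Fin (suc n) → A) →
  tabulate f ≡ tabulate (f ∘ punchIn (fromℕ n)) ∷ʳ f (fromℕ n)
tabulate-punchIn-last zero    f = refl
tabulate-punchIn-last (suc n) f = cong (f zero ∷_) (tabulate-punchIn-last n (f ∘ suc))

length-filter-tabulate-mono : ∀ {a b p q} {A : Set a} {B : Set b} {P : Pred A p} {Q : Pred B q}
  (P? : Decidable P) (Q? : Decidable Q) {n} (f : Fin n → A) (g : Fin n → B) →
  (∀ k → P (f k) → Q (g k)) →
  length (filter P? (tabulate f)) ≤ length (filter Q? (tabulate g))
length-filter-tabulate-mono P? Q? {zero}  f g P⇒Q = z≤n
length-filter-tabulate-mono P? Q? {suc n} f g P⇒Q
  with P? (f zero) | Q? (g zero) | length-filter-tabulate-mono P? Q? (f ∘ suc) (g ∘ suc) (P⇒Q ∘ suc)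
... | yes p | yes q | rec = s≤s rec
... | yes p | no ¬q | rec = contradiction (P⇒Q zero p) ¬q
... | no ¬p | yes q | rec = m≤n⇒m≤1+n rec
... | no ¬p | no ¬q | rec = rec

module _ {n} (σ : Fin (suc n) → Fin (suc n)) (σ′ : Fin n → Fin n)
  (shortcut : ∀ k → ∃ λ m → punchIn (fromℕ n) (σ′ k) ≡ iter σ m (punchIn (fromℕ n) k)) where

  iter-shortcut : ∀ j k → ∃ λ m → punchIn (fromℕ n) (iter σ′ j k) ≡ iter σ m (punchIn (fromℕ n) k)
  iter-shortcut zero    k = 0 , refl
  iter-shortcut (suc j) k with m , eq ← iter-shortcut j k | l , eq′ ← shortcut (iter σ′ j k) =
    l + m , trans eq′ (trans (cong (iter σ l) eq) (sym (iter-+ σ l m _)))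

  -- The orbit of `k` under `σ′` embeds in an orbit of `σ`, and `punchIn` reflects the order, so a
  -- minimum over the larger orbit stays one over the smaller.
  cycleMin-shortcut : ∀ k → isCycleMin σ (punchIn (fromℕ n) k) → isCycleMin σ′ k
  cycleMin-shortcut k min j with m , eq ← iter-shortcut (toℕ j) k =
    punchIn-cancel-≤ (fromℕ n) k _
      (subst (punchIn (fromℕ n) k Fin.≤_) (sym eq) (cycleMin-≤-iter σ min m))

  cyc-split : cyc σ ≤ cyc σ′ + length (filter (isCycleMin? σ) [ fromℕ n ])
  cyc-split = begin
    length (filter P? (tabulate id))                      ≡⟨ cong (length ∘ filter P?) (tabulate-punchIn-last n id) ⟩
    length (filter P? (tabulate (punchIn (fromℕ n)) ∷ʳ fromℕ n))
      ≡⟨ cong length (filter-++ P? (tabulate (punchIn (fromℕ n))) [ fromℕ n ]) ⟩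
    length (filter P? (tabulate (punchIn (fromℕ n))) ++ filter P? [ fromℕ n ])
      ≡⟨ length-++ (filter P? (tabulate (punchIn (fromℕ n)))) ⟩
    length (filter P? (tabulate (punchIn (fromℕ n)))) + length (filter P? [ fromℕ n ])
      ≤⟨ +-monoˡ-≤ _ (length-filter-tabulate-mono P? (isCycleMin? σ′) (punchIn (fromℕ n)) id cycleMin-shortcut) ⟩
    cyc σ′ + length (filter P? [ fromℕ n ])               ∎
    where
    open ≤-Reasoning
    P? = isCycleMin? σ

  cyc-shortcut-≤-suc : cyc σ ≤ suc (cyc σ′)
  cyc-shortcut-≤-suc = begin
    cyc σ                                                  ≤⟨ cyc-split ⟩
    cyc σ′ + length (filter (isCycleMin? σ) [ fromℕ n ])   ≤⟨ +-monoʳ-≤ (cyc σ′) (length-filter (isCycleMin? σ) [ fromℕ n ]) ⟩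
    cyc σ′ + 1                                             ≡⟨ +-comm (cyc σ′) 1 ⟩
    suc (cyc σ′)                                           ∎
    where open ≤-Reasoning

  -- Being the largest point, `fromℕ n` can be the least of its cycle only when it is fixed. If it
  -- moves, every cycle minimum of `σ` survives in `σ′`.
  cyc-shortcut-≤ : σ (fromℕ n) ≢ fromℕ n → cyc σ ≤ cyc σ′
  cyc-shortcut-≤ moved = begin
    cyc σ                                                  ≤⟨ cyc-split ⟩
    cyc σ′ + length (filter (isCycleMin? σ) [ fromℕ n ])   ≡⟨ cong (λ xs → cyc σ′ + length xs) (filter-reject (isCycleMin? σ) not-min) ⟩
    cyc σ′ + 0                                             ≡⟨ +-identityʳ _ ⟩
    cyc σ′                                                 ∎
    where
    open ≤-Reasoning
    not-min : ¬ isCycleMin σ (fromℕ n)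
    not-min min = moved (Fin.≤-antisym (Fin.≤fromℕ _) (cycleMin-≤-iter σ min 1))

-- Removing and inserting the last point

insert-at : ∀ {n} i j (π : Permutation′ n) → insert i j π ⟨$⟩ʳ i ≡ j
insert-at i j π with i Fin.≟ i
... | yes _   = refl
... | no  i≢i = contradiction refl i≢i

-- τ is redirected so that last goes to a and the former preimage of a takes over the value τ last;
-- the rest is a bijection between the complements of last and of a.
bypass : ∀ {n} → Fin (suc n) → Permutation′ (suc n) → Permutation′ n
bypass {n} a τ = remove (fromℕ n) (τ ∘ₚ transpose (τ ⟨$⟩ʳ fromℕ n) a)

module _ {n} (a : Fin (suc n)) (τ : Permutation′ (suc n)) (π : Permutation′ n) where
  private
    last = fromℕ n
    σ : Fin (suc n) → Fin (suc n)
    σ x = insert a last π ⟨$⟩ʳ (τ ⟨$⟩ʳ x)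
    t = transpose (τ ⟨$⟩ʳ last) a

  transpose-left : t ⟨$⟩ʳ (τ ⟨$⟩ʳ last) ≡ a
  transpose-left with (τ ⟨$⟩ʳ last) Fin.≟ (τ ⟨$⟩ʳ last)
  ... | yes _ = refl
  ... | no ≢  = contradiction refl ≢

  private
    unfold : ∀ k → punchIn last (π ⟨$⟩ʳ (bypass a τ ⟨$⟩ʳ k)) ≡
             insert a last π ⟨$⟩ʳ (t ⟨$⟩ʳ (τ ⟨$⟩ʳ punchIn last k))
    unfold k = begin
      punchIn last (π ⟨$⟩ʳ (bypass a τ ⟨$⟩ʳ k))               ≡⟨ insert-punchIn a last π _ ⟨
      insert a last π ⟨$⟩ʳ punchIn a (bypass a τ ⟨$⟩ʳ k)
        ≡⟨ cong (λ b → insert a last π ⟨$⟩ʳ punchIn b (bypass a τ ⟨$⟩ʳ k)) transpose-left ⟨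
      insert a last π ⟨$⟩ʳ punchIn (t ⟨$⟩ʳ (τ ⟨$⟩ʳ last)) (bypass a τ ⟨$⟩ʳ k)
        ≡⟨ cong (insert a last π ⟨$⟩ʳ_) (punchIn-permute (τ ∘ₚ t) last k) ⟨
      insert a last π ⟨$⟩ʳ (t ⟨$⟩ʳ (τ ⟨$⟩ʳ punchIn last k))   ∎
      where open ≡-Reasoning

  -- If `τ` does not send the point to `a`, one step of `σ` suffices. If it does, `σ` enters `last`,
  -- and a second step leaves it through the value `τ last` that the transposition put in place of
  -- `a`.
  bypass-shortcut : ∀ k → ∃ λ m →
    punchIn last (π ⟨$⟩ʳ (bypass a τ ⟨$⟩ʳ k)) ≡ iter σ m (punchIn last k)
  bypass-shortcut k with eq ← unfold k | (τ ⟨$⟩ʳ punchIn last k) Fin.≟ (τ ⟨$⟩ʳ last)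
  ... | yes hit = contradiction (Injection.injective (↔⇒↣ τ) hit) (punchInᵢ≢i last k)
  ... | no _ with (τ ⟨$⟩ʳ punchIn last k) Fin.≟ a
  ...   | no _   = 1 , eq
  ...   | yes ≡a = 2 , trans eq (cong σ (sym (trans (cong (insert a last π ⟨$⟩ʳ_) ≡a) (insert-at a last π))))

  cyc-insert-≤-suc : cyc σ ≤ suc (cyc (λ x → π ⟨$⟩ʳ (bypass a τ ⟨$⟩ʳ x)))
  cyc-insert-≤-suc = cyc-shortcut-≤-suc σ _ bypass-shortcut

  -- `insert a last π` takes the value `last` only at `a`, so `σ` fixes `last` only if `τ` sends it
  -- to `a`.
  cyc-insert-≤ : τ ⟨$⟩ʳ last ≢ a → cyc σ ≤ cyc (λ x → π ⟨$⟩ʳ (bypass a τ ⟨$⟩ʳ x))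
  cyc-insert-≤ τl≢a = cyc-shortcut-≤ σ _ bypass-shortcut λ fixed →
    τl≢a (Injection.injective (↔⇒↣ (insert a last π)) (trans fixed (sym (insert-at a last π))))

-- Rotations as permutations

rotation : ∀ {n} → Fin n → Permutation′ n
-- For `i = 0` the inverse shift is the full turn `suc n`, which reduction modulo `suc n` makes
-- trivial.
rotation {suc n} i = permutation (rot (toℕ i)) (rot (suc n ∸ toℕ i))
  (λ x → rot-rot _ _ (m∸n+n≡m (<⇒≤ (toℕ<n i))) x) (λ x → rot-rot _ _ (m+[n∸m]≡n (<⇒≤ (toℕ<n i))) x)
  where
  open ≡-Reasoning
  rot-rot : ∀ a b → a + b ≡ suc n → (x : Fin (suc n)) → rot b (rot a x) ≡ x
  rot-rot a b a+b≡n x = toℕ-injective (begin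
    toℕ (rot b (rot a x))                    ≡⟨ toℕ-fromℕ< _ ⟩
    (toℕ (rot a x) + b) % suc n              ≡⟨ cong (λ y → (y + b) % suc n) (toℕ-fromℕ< (m%n<n (toℕ x + a) (suc n))) ⟩
    ((toℕ x + a) % suc n + b) % suc n        ≡⟨ %-distribˡ-+ ((toℕ x + a) % suc n) b (suc n) ⟩
    ((toℕ x + a) % suc n % suc n + b % suc n) % suc n
      ≡⟨ cong (λ y → (y + b % suc n) % suc n) (m%n%n≡m%n (toℕ x + a) (suc n)) ⟩
    ((toℕ x + a) % suc n + b % suc n) % suc n  ≡⟨ %-distribˡ-+ (toℕ x + a) b (suc n) ⟨
    (toℕ x + a + b) % suc n                  ≡⟨ cong (_% suc n) (trans (+-assoc (toℕ x) a b) (cong (λ y → toℕ x + y) a+b≡n)) ⟩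
    (toℕ x + suc n) % suc n                  ≡⟨ [m+n]%n≡m%n (toℕ x) (suc n) ⟩
    toℕ x % suc n                            ≡⟨ m<n⇒m%n≡m (toℕ<n x) ⟩
    toℕ x                                    ∎)

-- Conditional expectations

∃≤average : ∀ {r} (f : Fin (suc r) → ℕ) → ∃ λ a → suc r * f a ≤ sum f
∃≤average {zero}  f = zero , ≤-refl
∃≤average {suc r} f with a , bound ← ∃≤average (f ∘ suc) with ≤-total (f zero) (f (suc a))
... | inj₁ f0≤fa = zero , +-monoʳ-≤ (f zero) (≤-trans (*-monoʳ-≤ (suc r) f0≤fa) bound)
... | inj₂ fa≤f0 = suc a , +-mono-≤ fa≤f0 bound

sum-const : ∀ n c → sum {n} (λ _ → c) ≡ n * c
sum-const zero    c = refl
sum-const (suc n) c = cong (λ x → c + x) (sum-const n c)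

+-≤-sum : ∀ {r} (f : Fin (suc r) → ℕ) → (∀ i → 1 ≤ f i) → ∀ i → f i + r ≤ sum f
+-≤-sum {r} f f≥1 zero = +-monoʳ-≤ (f zero) (r≤sum (f ∘ suc) (f≥1 ∘ suc))
  where
  r≤sum : ∀ {r} (f : Fin r → ℕ) → (∀ i → 1 ≤ f i) → r ≤ sum f
  r≤sum {zero}  f f≥1 = z≤n
  r≤sum {suc r} f f≥1 = +-mono-≤ (f≥1 zero) (r≤sum (f ∘ suc) (f≥1 ∘ suc))
+-≤-sum {suc r} f f≥1 (suc i) = begin
  f (suc i) + suc r      ≡⟨ +-suc (f (suc i)) r ⟩
  1 + (f (suc i) + r)    ≤⟨ +-mono-≤ (f≥1 zero) (+-≤-sum (f ∘ suc) (f≥1 ∘ suc) i) ⟩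
  f zero + sum (f ∘ suc) ∎
  where open ≤-Reasoning

module _ (A B : ℕ) where

  -- B ^ n times the rising factorial x (x + 1) ⋯ (x + n − 1) at x = A / B.
  rising : ℕ → ℕ
  rising zero    = 1
  rising (suc n) = rising n * (A + n * B)

  -- The factor earned by one placement: `A` if it may close a new cycle, `B` if not, that is `x` or
  -- 1 after division by `B`.
  pick : Bool → ℕ
  pick b = if b then A else B

  sum-pick : ∀ {n} (b : Fin (suc n)) → sum (λ a → pick (does (b Fin.≟ a))) ≡ A + n * B
  sum-pick {n}     zero    = cong (λ x → A + x) (sum-const n B)
  sum-pick {suc n} (suc b) = trans (cong (λ x → B + x) (sum-pick b)) (lemma A B (n * B))
    where
    lemma : ∀ x y z → y + (x + z) ≡ x + (y + z)
    lemma = solve-∀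

  -- The exponent `p i` makes every term homogeneous of degree `n`. For `B > 0`, division by
  -- `n ! * B ^ n` turns the last clause into a bound of the weighted sum of `x ^ q i` by its mean
  -- over random permutations. The weights record the factors already decided.
  FewCycles : ∀ {n r} → (Fin r → Permutation′ n) → (Fin r → ℕ) → Set
  FewCycles {n} {r} τ w =
    ∃ λ (π : Permutation′ n) → ∃ λ (q : Fin r → ℕ) → ∃ λ (p : Fin r → ℕ) →
      (∀ i → q i + p i ≡ n) ×
      (∀ i → cyc (λ x → π ⟨$⟩ʳ (τ i ⟨$⟩ʳ x)) ≤ q i) ×
      n ! * sum (λ i → w i * (A ^ q i * B ^ p i)) ≤ sum w * rising n

  private module Step {n r} (τ : Fin r → Permutation′ (suc n)) (w : Fin r → ℕ) where
    hit : Fin (suc n) → Fin r → Bool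
    hit a i = does ((τ i ⟨$⟩ʳ fromℕ n) Fin.≟ a)

    w′ : Fin (suc n) → Fin r → ℕ
    w′ a i = w i * pick (hit a i)

    -- After exchanging the sums, each `i` is hit by exactly one of the `n + 1` choices of `a`; this
    -- produces the next factor of `rising`.
    total : sum (λ a → sum (w′ a)) ≡ sum w * (A + n * B)
    total = begin
      sum (λ a → sum (w′ a))                        ≡⟨ ∑-comm w′ ⟩
      sum (λ i → sum (λ a → w i * pick (hit a i)))  ≡⟨ sum-cong-≗ (λ i → sym (*-distribˡ-sum (w i) (λ a → pick (hit a i)))) ⟩
      sum (λ i → w i * sum (λ a → pick (hit a i)))  ≡⟨ sum-cong-≗ (λ i → cong (w i *_) (sum-pick (τ i ⟨$⟩ʳ fromℕ n))) ⟩
      sum (λ i → w i * (A + n * B))                 ≡⟨ *-distribʳ-sum (A + n * B) w ⟨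
      sum w * (A + n * B)                           ∎
      where open ≡-Reasoning

    module _ (a : Fin (suc n)) (average : suc n * sum (w′ a) ≤ sum (λ a → sum (w′ a)))
      (π′ : Permutation′ n) (q′ p′ : Fin r → ℕ) (q′+p′≡ : ∀ i → q′ i + p′ i ≡ n)
      (cyc≤q′ : ∀ i → cyc (λ x → π′ ⟨$⟩ʳ (bypass a (τ i) ⟨$⟩ʳ x)) ≤ q′ i)
      (bound′ : n ! * sum (λ i → w′ a i * (A ^ q′ i * B ^ p′ i)) ≤ sum (w′ a) * rising n) where

      π : Permutation′ (suc n)
      π = insert a (fromℕ n) π′
      q p : Fin r → ℕ
      -- Only a hit can create a cycle; otherwise the new degree goes to the exponent of `B`.
      q i = if hit a i then suc (q′ i) else q′ i
      p i = if hit a i then p′ i else suc (p′ i)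

      q+p≡ : ∀ i → q i + p i ≡ suc n
      q+p≡ i with hit a i
      ... | true  = cong suc (q′+p′≡ i)
      ... | false = trans (+-suc (q′ i) (p′ i)) (cong suc (q′+p′≡ i))

      cyc≤q : ∀ i → cyc (λ x → π ⟨$⟩ʳ (τ i ⟨$⟩ʳ x)) ≤ q i
      cyc≤q i with (τ i ⟨$⟩ʳ fromℕ n) Fin.≟ a
      ... | yes _   = ≤-trans (cyc-insert-≤-suc a (τ i) π′) (s≤s (cyc≤q′ i))
      ... | no  τ≢a = ≤-trans (cyc-insert-≤ a (τ i) π′ τ≢a) (cyc≤q′ i)

      weight : ∀ i → w i * (A ^ q i * B ^ p i) ≡ w′ a i * (A ^ q′ i * B ^ p′ i)
      weight i with hit a i
      ... | true  = lemma (w i) A (A ^ q′ i) (B ^ p′ i)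
        where
        lemma : ∀ w x y z → w * (x * y * z) ≡ w * x * (y * z)
        lemma = solve-∀
      ... | false = lemma (w i) B (A ^ q′ i) (B ^ p′ i)
        where
        lemma : ∀ w x y z → w * (y * (x * z)) ≡ w * x * (y * z)
        lemma = solve-∀

      bound : suc n ! * sum (λ i → w i * (A ^ q i * B ^ p i)) ≤ sum w * rising (suc n)
      bound = begin
        suc n * n ! * sum (λ i → w i * (A ^ q i * B ^ p i))          ≡⟨ *-assoc (suc n) (n !) _ ⟩
        suc n * (n ! * sum (λ i → w i * (A ^ q i * B ^ p i)))        ≡⟨ cong (λ s → suc n * (n ! * s)) (sum-cong-≗ weight) ⟩
        suc n * (n ! * sum (λ i → w′ a i * (A ^ q′ i * B ^ p′ i)))   ≤⟨ *-monoʳ-≤ (suc n) bound′ ⟩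
        suc n * (sum (w′ a) * rising n)                              ≡⟨ *-assoc (suc n) (sum (w′ a)) (rising n) ⟨
        suc n * sum (w′ a) * rising n                                ≤⟨ *-monoˡ-≤ (rising n) average ⟩
        sum (λ a → sum (w′ a)) * rising n                            ≡⟨ cong (_* rising n) total ⟩
        sum w * (A + n * B) * rising n                               ≡⟨ *-assoc (sum w) (A + n * B) (rising n) ⟩
        sum w * ((A + n * B) * rising n)                             ≡⟨ cong (sum w *_) (*-comm (A + n * B) (rising n)) ⟩
        sum w * (rising n * (A + n * B))                             ∎
        where open ≤-Reasoning

      extend : FewCycles τ w
      extend = π , q , p , q+p≡ , cyc≤q , bound

  -- Method of conditional expectations: the value π⁻¹ last = a is chosen so that the
  -- expected weighted sum of (A / B) ^ cyc (π τᵢ) over the remaining random choices does not increase.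
  ∃-few-cycles : ∀ {n r} (τ : Fin r → Permutation′ n) (w : Fin r → ℕ) → FewCycles τ w
  ∃-few-cycles {zero} τ w = idₚ , (λ _ → 0) , (λ _ → 0) , (λ _ → refl) , (λ _ → z≤n) ,
    ≤-reflexive (begin
      1 * sum (λ i → w i * 1)   ≡⟨ *-identityˡ _ ⟩
      sum (λ i → w i * 1)       ≡⟨ *-distribʳ-sum 1 w ⟨
      sum w * 1                 ∎)
    where open ≡-Reasoning
  ∃-few-cycles {suc n} τ w =
    let open Step τ w
        a , average = ∃≤average (λ a → sum (w′ a))
        -- The factor decided by `a` passes into the weights, so the recursive call has the same
        -- shape.
        π′ , q′ , p′ , q′+p′≡ , cyc≤q′ , bound′ = ∃-few-cycles (λ i → bypass a (τ i)) (w′ a)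
    in extend a average π′ q′ p′ q′+p′≡ cyc≤q′ bound′

-- Bernoulli's inequality, harmonic numbers and e

-- Bernoulli's inequality for `1 + y / x`, multiplied through by `x ^ suc m`. The induction discards
-- the term quadratic in `y`.
bernoulli : ∀ x y m → x ^ m * (x + suc m * y) ≤ (x + y) ^ suc m
bernoulli x y zero = ≤-reflexive (lemma x y)
  where
  lemma : ∀ x y → 1 * (x + 1 * y) ≡ (x + y) * 1
  lemma = solve-∀
bernoulli x y (suc m) = begin
  x * x ^ m * (x + (y + suc m * y))              ≤⟨ m≤m+n _ _ ⟩
  x * x ^ m * (x + (y + suc m * y)) + x ^ m * (y * (suc m * y))
                                                 ≡⟨ lemma x y (suc m * y) (x ^ m) ⟩
  (x + y) * (x ^ m * (x + suc m * y))            ≤⟨ *-monoʳ-≤ (x + y) (bernoulli x y m) ⟩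
  (x + y) * (x + y) ^ suc m                      ∎
  where
  open ≤-Reasoning
  lemma : ∀ x y z u → x * u * (x + (y + z)) + u * (y * z) ≡ (x + y) * (u * (x + z))
  lemma = solve-∀

-- The homogeneous form of `1 + m / b ≤ (1 + 1 / b) ^ m`.
bernoulli₁ : ∀ b m → (b + m) * b ^ m ≤ (b + 1) ^ m * b
bernoulli₁ b zero = ≤-reflexive (lemma b)
  where
  lemma : ∀ b → (b + 0) * 1 ≡ 1 * b
  lemma = solve-∀
bernoulli₁ b (suc m) = begin
  (b + suc m) * (b * b ^ m)            ≡⟨ lemma b (suc m) (b ^ m) ⟩
  b ^ m * (b + suc m * 1) * b          ≤⟨ *-monoˡ-≤ b (bernoulli b 1 m) ⟩
  (b + 1) ^ suc m * b                  ∎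
  where
  open ≤-Reasoning
  lemma : ∀ b m u → (b + m) * (b * u) ≡ u * (b + m * 1) * b
  lemma = solve-∀

-- harm N = N! · (1 + 1/2 + ⋯ + 1/N)
harm : ℕ → ℕ
harm zero    = 0
harm (suc N) = suc N * harm N + N !

-- The factors of `rising` with index 1 to `N`, the factor `A` of index 0 being split off.
rising₁ : ℕ → ℕ → ℕ → ℕ
rising₁ A B zero    = 1
rising₁ A B (suc N) = rising₁ A B N * (A + suc N * B)

-- With a = F · N! / j one has k F N! + j B = j (B + k a) and B + k a ≤ B (1 + 1/B) ^ (k a).
rising₁-bound : ∀ k B N F →
  rising₁ (k * (F * N !)) B N * B ^ (k * (F * harm N)) ≤ N ! * ((B + 1) ^ (k * (F * harm N)) * B ^ N)
rising₁-bound k B zero F rewrite *-zeroʳ F | *-zeroʳ k = ≤-refl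
rising₁-bound k B (suc N) F = begin
  rising₁ (k * (F * (suc N * N !))) B N * (k * (F * (suc N * N !)) + suc N * B) * B ^ (k * (F * (suc N * harm N + N !)))
    ≡⟨ cong₂ (λ x y → rising₁ x B N * (x + suc N * B) * B ^ y) (A≡ k F (suc N) (N !)) exp≡ ⟩
  rising₁ (k * (F′ * N !)) B N * (k * (F′ * N !) + suc N * B) * B ^ (k * (F′ * harm N) + m)
    ≡⟨ cong (rising₁ (k * (F′ * N !)) B N * (k * (F′ * N !) + suc N * B) *_) (^-distribˡ-+-* B (k * (F′ * harm N)) m) ⟩
  rising₁ (k * (F′ * N !)) B N * (k * (F′ * N !) + suc N * B) * (B ^ (k * (F′ * harm N)) * B ^ m)
    ≡⟨ regroup (rising₁ (k * (F′ * N !)) B N) k F (suc N) (N !) B (B ^ (k * (F′ * harm N))) (B ^ m) ⟩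
  suc N * (rising₁ (k * (F′ * N !)) B N * B ^ (k * (F′ * harm N))) * ((B + m) * B ^ m)
    ≤⟨ *-mono-≤ (*-monoʳ-≤ (suc N) (rising₁-bound k B N F′)) (bernoulli₁ B m) ⟩
  suc N * (N ! * ((B + 1) ^ (k * (F′ * harm N)) * B ^ N)) * ((B + 1) ^ m * B)
    ≡⟨ regroup′ (suc N) (N !) ((B + 1) ^ (k * (F′ * harm N))) (B ^ N) ((B + 1) ^ m) B ⟩
  suc N * N ! * ((B + 1) ^ (k * (F′ * harm N)) * (B + 1) ^ m * (B * B ^ N))
    ≡⟨ cong (λ x → suc N * N ! * (x * (B * B ^ N))) (^-distribˡ-+-* (B + 1) (k * (F′ * harm N)) m) ⟨
  suc N * N ! * ((B + 1) ^ (k * (F′ * harm N) + m) * (B * B ^ N))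
    ≡⟨ cong (λ x → suc N * N ! * ((B + 1) ^ x * (B * B ^ N))) exp≡ ⟨
  suc N * N ! * ((B + 1) ^ (k * (F * (suc N * harm N + N !))) * (B * B ^ N))
    ∎
  where
  open ≤-Reasoning
  -- `F` collects the factors by which `N !` shrinks under recursion, so that `A = k * (F * N !)`
  -- remains the same number throughout.
  F′ = F * suc N
  m = k * (F * N !)
  A≡ : ∀ k F s f → k * (F * (s * f)) ≡ k * (F * s * f)
  A≡ = solve-∀
  exp : ∀ k F s h f → k * (F * (s * h + f)) ≡ k * (F * s * h) + k * (F * f)
  exp = solve-∀
  exp≡ = exp k F (suc N) (harm N) (N !)
  regroup : ∀ r k F s f B u v → r * (k * (F * s * f) + s * B) * (u * v) ≡ s * (r * u) * ((B + k * (F * f)) * v)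
  regroup = solve-∀
  regroup′ : ∀ s f u v x B → s * (f * (u * v)) * (x * B) ≡ s * f * (u * x * (B * v))
  regroup′ = solve-∀

-- expSum W m c = m! · Wᵐ · Σ_{i ≤ m} (c/W)ⁱ / i!
expSum : ℕ → ℕ → ℕ → ℕ
expSum W zero    c = 1
expSum W (suc m) c = suc m * W * expSum W m c + c ^ suc m

-- Moving the argument of the truncated exponential by `1 / W` gains at least `1 / W` times its
-- derivative, which is the truncation one degree lower. Termwise this is Bernoulli's inequality.
expSum-step : ∀ W m c → expSum W (suc m) c + suc m * expSum W m c ≤ expSum W (suc m) (c + 1)
expSum-step W zero c = ≤-reflexive (lemma W c)
  where
  lemma : ∀ W c → 1 * W * 1 + c * 1 + 1 * 1 ≡ 1 * W * 1 + (c + 1) * 1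
  lemma = solve-∀
expSum-step W (suc m) c = begin
  (s * W * V₁ + c * c ^ suc m) + s * (suc m * W * V₀ + c ^ suc m)
    ≡⟨ lemma (suc m) s W V₁ V₀ c (c ^ suc m) ⟩
  s * W * (V₁ + suc m * V₀) + c ^ suc m * (c + s * 1)
    ≤⟨ +-mono-≤ (*-monoʳ-≤ (s * W) (expSum-step W m c)) (bernoulli c 1 (suc m)) ⟩
  s * W * expSum W (suc m) (c + 1) + (c + 1) ^ s ∎
  where
  open ≤-Reasoning
  s = suc (suc m)
  V₁ = expSum W (suc m) c
  V₀ = expSum W m c
  lemma : ∀ t s W V₁ V₀ c u → (s * W * V₁ + c * u) + s * (t * W * V₀ + u) ≡ s * W * (V₁ + t * V₀) + u * (c + s * 1)
  lemma = solve-∀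

-- Degree and argument grow together: passing from degree `m` at `m / W` to degree `m + 1` at
-- `(m + 1) / W` multiplies the truncated exponential by at least `1 + 1 / W`.
^-≤-expSum : ∀ W m → m ! * (W + 1) ^ m ≤ expSum W m m
^-≤-expSum W zero    = ≤-refl
^-≤-expSum W (suc m) = begin
  suc m * m ! * ((W + 1) * (W + 1) ^ m)          ≡⟨ lemma (suc m) (m !) (W + 1) ((W + 1) ^ m) ⟩
  suc m * (W + 1) * (m ! * (W + 1) ^ m)          ≤⟨ *-monoʳ-≤ (suc m * (W + 1)) (^-≤-expSum W m) ⟩
  suc m * (W + 1) * expSum W m m                 ≤⟨ m≤m+n _ (m ^ suc m) ⟩
  suc m * (W + 1) * expSum W m m + m ^ suc m     ≡⟨ lemma′ (suc m) W (expSum W m m) (m ^ suc m) ⟩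
  expSum W (suc m) m + suc m * expSum W m m      ≤⟨ expSum-step W m m ⟩
  expSum W (suc m) (m + 1)                       ≡⟨ cong (expSum W (suc m)) (+-comm m 1) ⟩
  expSum W (suc m) (suc m)                       ∎
  where
  open ≤-Reasoning
  lemma : ∀ s f x y → s * f * (x * y) ≡ s * x * (f * y)
  lemma = solve-∀
  lemma′ : ∀ s W v c → s * (W + 1) * v + c ≡ s * W * v + c + s * v
  lemma′ = solve-∀

-- eNum m = m! · Σ_{i ≤ m} 1 / i!
eNum : ℕ → ℕ
eNum zero    = 1
eNum (suc m) = suc m * eNum m + 1

expSum-diagonal : ∀ W m → expSum W m W ≡ W ^ m * eNum m
expSum-diagonal W zero    = refl
expSum-diagonal W (suc m) = begin
  suc m * W * expSum W m W + W * W ^ m        ≡⟨ cong (λ x → suc m * W * x + W * W ^ m) (expSum-diagonal W m) ⟩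
  suc m * W * (W ^ m * eNum m) + W * W ^ m    ≡⟨ lemma (suc m) W (W ^ m) (eNum m) ⟩
  W * W ^ m * (suc m * eNum m + 1)            ∎
  where
  open ≡-Reasoning
  lemma : ∀ s W u e → s * W * (u * e) + W * u ≡ W * u * (s * e + 1)
  lemma = solve-∀

-- The slack `d` lets the partial sum of e run past `W`, since one truncation level has to serve the
-- logarithm as well.
[1+1/W]^W≤e : ∀ W d → (d + W) ! * (W + 1) ^ W ≤ W ^ W * eNum (d + W)
[1+1/W]^W≤e W zero    = ≤-trans (^-≤-expSum W W) (≤-reflexive (expSum-diagonal W W))
[1+1/W]^W≤e W (suc d) = begin
  suc (d + W) * (d + W) ! * (W + 1) ^ W              ≡⟨ *-assoc (suc (d + W)) ((d + W) !) _ ⟩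
  suc (d + W) * ((d + W) ! * (W + 1) ^ W)            ≤⟨ *-monoʳ-≤ (suc (d + W)) ([1+1/W]^W≤e W d) ⟩
  suc (d + W) * (W ^ W * eNum (d + W))               ≤⟨ m≤m+n _ (W ^ W) ⟩
  suc (d + W) * (W ^ W * eNum (d + W)) + W ^ W       ≡⟨ lemma (suc (d + W)) (W ^ W) (eNum (d + W)) ⟩
  W ^ W * (suc (d + W) * eNum (d + W) + 1)           ∎
  where
  open ≤-Reasoning
  lemma : ∀ s u e → s * (u * e) + u ≡ u * (s * e + 1)
  lemma = solve-∀

-- Rational approximations of e and ln

toℚᵘ-/ : ∀ a b → toℚᵘ (+ a / suc b) ℚᵘ.≃ mkℚᵘ (+ a) b
toℚᵘ-/ a b = ℚ.toℚᵘ-fromℚᵘ (mkℚᵘ (+ a) b)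

/-≤ : ∀ a b c d .{{_ : NonZero b}} .{{_ : NonZero d}} → a * d ≤ c * b → + a / b ℚ.≤ + c / d
/-≤ a (suc b) c (suc d) ad≤cb = ℚ.toℚᵘ-cancel-≤ (begin
  toℚᵘ (+ a / suc b)   ≃⟨ toℚᵘ-/ a b ⟩
  mkℚᵘ (+ a) b         ≤⟨ *≤* (subst₂ ℤ._≤_ (ℤ.pos-* a (suc d)) (ℤ.pos-* c (suc b)) (ℤ.+≤+ ad≤cb)) ⟩
  mkℚᵘ (+ c) d         ≃⟨ toℚᵘ-/ c d ⟨
  toℚᵘ (+ c / suc d)   ∎)
  where open ℚᵘ.≤-Reasoning

/-≤⁻¹ : ∀ a b c d .{{_ : NonZero b}} .{{_ : NonZero d}} → + a / b ℚ.≤ + c / d → a * d ≤ c * b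
/-≤⁻¹ a (suc b) c (suc d) le = cross (begin
  mkℚᵘ (+ a) b         ≃⟨ toℚᵘ-/ a b ⟨
  toℚᵘ (+ a / suc b)   ≤⟨ ℚ.toℚᵘ-mono-≤ le ⟩
  toℚᵘ (+ c / suc d)   ≃⟨ toℚᵘ-/ c d ⟩
  mkℚᵘ (+ c) d         ∎)
  where
  open ℚᵘ.≤-Reasoning
  cross : mkℚᵘ (+ a) b ℚᵘ.≤ mkℚᵘ (+ c) d → a * suc d ≤ c * suc b
  cross (*≤* le) = ℤ.drop‿+≤+ (subst₂ ℤ._≤_ (sym (ℤ.pos-* a (suc d))) (sym (ℤ.pos-* c (suc b))) le)

/-+ : ∀ a b c d .{{_ : NonZero b}} .{{_ : NonZero d}} →
  (+ a / b) ℚ.+ (+ c / d) ≡ _/_ (+ (a * d + c * b)) (b * d) {{m*n≢0 b d}}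
/-+ a (suc b) c (suc d) = ℚ.toℚᵘ-injective (begin
  toℚᵘ ((+ a / suc b) ℚ.+ (+ c / suc d))          ≈⟨ ℚ.toℚᵘ-homo-+ (+ a / suc b) (+ c / suc d) ⟩
  toℚᵘ (+ a / suc b) ℚᵘ.+ toℚᵘ (+ c / suc d)      ≈⟨ ℚᵘ.+-cong (toℚᵘ-/ a b) (toℚᵘ-/ c d) ⟩
  mkℚᵘ (+ a) b ℚᵘ.+ mkℚᵘ (+ c) d
    ≡⟨ cong (λ x → mkℚᵘ x _) (cong₂ ℤ._+_ (ℤ.pos-* a (suc d)) (ℤ.pos-* c (suc b))) ⟨
  mkℚᵘ (+ (a * suc d + c * suc b)) (d + b * suc d)
    ≈⟨ toℚᵘ-/ (a * suc d + c * suc b) (d + b * suc d) ⟨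
  toℚᵘ (+ (a * suc d + c * suc b) / (suc b * suc d)) ∎)
  where open ℚᵘ.≃-Reasoning

/-* : ∀ a b c d .{{_ : NonZero b}} .{{_ : NonZero d}} →
  (+ a / b) ℚ.* (+ c / d) ≡ _/_ (+ (a * c)) (b * d) {{m*n≢0 b d}}
/-* a (suc b) c (suc d) = ℚ.toℚᵘ-injective (begin
  toℚᵘ ((+ a / suc b) ℚ.* (+ c / suc d))          ≈⟨ ℚ.toℚᵘ-homo-* (+ a / suc b) (+ c / suc d) ⟩
  toℚᵘ (+ a / suc b) ℚᵘ.* toℚᵘ (+ c / suc d)      ≈⟨ ℚᵘ.*-cong (toℚᵘ-/ a b) (toℚᵘ-/ c d) ⟩
  mkℚᵘ (+ a) b ℚᵘ.* mkℚᵘ (+ c) d                  ≡⟨ cong (λ x → mkℚᵘ x _) (ℤ.pos-* a c) ⟨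
  mkℚᵘ (+ (a * c)) (d + b * suc d)                ≈⟨ toℚᵘ-/ (a * c) (d + b * suc d) ⟨
  toℚᵘ (+ (a * c) / (suc b * suc d))              ∎)
  where open ℚᵘ.≃-Reasoning

/-sum-≤ : ∀ a b c d e f .{{_ : NonZero b}} .{{_ : NonZero d}} .{{_ : NonZero f}} →
  (a * d + c * b) * f ≤ e * (b * d) → (+ a / b) ℚ.+ (+ c / d) ℚ.≤ + e / f
/-sum-≤ a b c d e f le = subst (ℚ._≤ + e / f) (sym (/-+ a b c d)) (/-≤ (a * d + c * b) (b * d) e f le)
  where instance _ = m*n≢0 b d

/-≤-sum : ∀ a b c d e f .{{_ : NonZero b}} .{{_ : NonZero d}} .{{_ : NonZero f}} →
  e * (b * d) ≤ (a * d + c * b) * f → + e / f ℚ.≤ (+ a / b) ℚ.+ (+ c / d)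
/-≤-sum a b c d e f le = subst (+ e / f ℚ.≤_) (sym (/-+ a b c d)) (/-≤ e f (a * d + c * b) (b * d) le)
  where instance _ = m*n≢0 b d

^-distribʳ-* : ∀ m n o → (n * o) ^ m ≡ n ^ m * o ^ m
^-distribʳ-* zero    n o = refl
^-distribʳ-* (suc m) n o = trans (cong (n * o *_) (^-distribʳ-* m n o)) (lemma n o (n ^ m) (o ^ m))
  where
  lemma : ∀ n o x y → n * o * (x * y) ≡ n * x * (o * y)
  lemma = solve-∀

ℚ-+-cancelʳ-≤ : ∀ r {p q} → p ℚ.+ r ℚ.≤ q ℚ.+ r → p ℚ.≤ q
ℚ-+-cancelʳ-≤ r {p} {q} le = subst₂ ℚ._≤_ (drop p) (drop q) (ℚ.+-monoˡ-≤ (ℚ.- r) le)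
  where
  drop : ∀ x → x ℚ.+ r ℚ.+ ℚ.- r ≡ x
  drop x = trans (ℚ.+-assoc x r (ℚ.- r)) (trans (cong (x ℚ.+_) (ℚ.+-inverseʳ r)) (ℚ.+-identityʳ x))

k*n^k≢0 : ∀ n j → NonZero (suc (2 * j) * suc n ^ suc (2 * j))
k*n^k≢0 n j = m*n≢0 (suc (2 * j)) (suc n ^ suc (2 * j)) {{_}} {{m^n≢0 (suc n) (suc (2 * j))}}

-- With `z = i / (i + 2)` this is `z ^ (2 + 2 m) ≤ 1 / (i + 2) ^ 2`. Bernoulli gives growth linear
-- in `m`, which is enough for `m` this large.
geometric-decay : ∀ i m → i * ((2 + i) * (2 + i)) ≤ m →
  (2 + i) * (2 + i) * i ^ (2 + 2 * m) ≤ (2 + i) ^ (2 + 2 * m)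
geometric-decay i m iss≤m = begin
  (2 + i) * (2 + i) * (i * i ^ suc (2 * m))        ≡⟨ lemma (2 + i) i (i ^ suc (2 * m)) ⟩
  i ^ suc (2 * m) * (i * ((2 + i) * (2 + i)))      ≤⟨ *-monoʳ-≤ (i ^ suc (2 * m)) large ⟩
  i ^ suc (2 * m) * (i + (2 + 2 * m) * 2)          ≤⟨ bernoulli i 2 (suc (2 * m)) ⟩
  (i + 2) ^ (2 + 2 * m)                            ≡⟨ cong (_^ (2 + 2 * m)) (+-comm i 2) ⟩
  (2 + i) ^ (2 + 2 * m)                            ∎
  where
  open ≤-Reasoning
  lemma : ∀ s i x → s * s * (i * x) ≡ x * (i * (s * s))
  lemma = solve-∀
  lemma′ : ∀ m i → m + (i + 4 + 3 * m) ≡ i + (2 + 2 * m) * 2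
  lemma′ = solve-∀
  large : i * ((2 + i) * (2 + i)) ≤ i + (2 + 2 * m) * 2
  large = ≤-trans iss≤m (≤-trans (m≤m+n m (i + 4 + 3 * m)) (≤-reflexive (lemma′ m i)))

-- With z = i / (i + 2), the argument of the series for ln (i + 1), and z′ = (i + 1) / (i + 3), the
-- argument for ln (i + 2): lnGain i j = 2 (z′ − z) z²ʲ bounds 2 (z′²ʲ⁺¹ − z²ʲ⁺¹) / (2j+1) from below.
module _ (i : ℕ) where
  private
    r = 1 + i
    s = 2 + i
    t = 3 + i

    s^*t≢0 : ∀ e → NonZero (s ^ e * t)
    s^*t≢0 e = m*n≢0 (s ^ e) t {{m^n≢0 s e}}

    r*t*s^≢0 : ∀ e → NonZero (r * t * s ^ e)
    r*t*s^≢0 e = m*n≢0 (r * t) (s ^ e) {{_}} {{m^n≢0 s e}}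

  lnGain : ℕ → ℚ
  lnGain j = _/_ (+ (4 * i ^ (2 * j))) (s ^ suc (2 * j) * t) {{s^*t≢0 (suc (2 * j))}}

  -- Multiplied by `s * t`, the arguments `z` and `z′` become `i * t` and `r * s = i * t + 2`, so
  -- Bernoulli with increment 2 bounds the difference of their `k`-th powers.
  lnTerm-step : ∀ j → lnTerm (suc i) j ℚ.+ lnGain j ℚ.≤ lnTerm (suc (suc i)) j
  lnTerm-step j = /-sum-≤ (2 * i ^ k) (k * s ^ k) (4 * i ^ κ) (s ^ k * t) (2 * r ^ k) (k * t ^ k)
    {{k*n^k≢0 (suc i) j}} {{s^*t≢0 k}} {{k*n^k≢0 (suc (suc i)) j}} (begin
      (2 * (i * i ^ κ) * (s ^ k * t) + 4 * i ^ κ * (k * s ^ k)) * (k * (t * t ^ κ))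
        ≡⟨ lemma i (i ^ κ) (s ^ k) t k (t ^ κ) ⟩
      2 * k * s ^ k * t * ((i ^ κ * t ^ κ) * (i * t + k * 2))
        ≡⟨ cong (λ x → 2 * k * s ^ k * t * (x * (i * t + k * 2))) (^-distribʳ-* κ i t) ⟨
      2 * k * s ^ k * t * ((i * t) ^ κ * (i * t + k * 2))
        ≤⟨ *-monoʳ-≤ (2 * k * s ^ k * t) (bernoulli (i * t) 2 κ) ⟩
      2 * k * s ^ k * t * (i * t + 2) ^ k
        ≡⟨ cong (λ x → 2 * k * s ^ k * t * x ^ k) (product i) ⟩
      2 * k * s ^ k * t * (r * s) ^ k
        ≡⟨ cong (2 * k * s ^ k * t *_) (^-distribʳ-* k r s) ⟩
      2 * k * s ^ k * t * (r ^ k * s ^ k)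
        ≡⟨ lemma′ k (s ^ k) t (r ^ k) ⟩
      2 * r ^ k * (k * s ^ k * (s ^ k * t)) ∎)
    where
    open ≤-Reasoning
    κ = 2 * j
    k = suc κ
    lemma : ∀ i a S t k b → (2 * (i * a) * (S * t) + 4 * a * (k * S)) * (k * (t * b)) ≡
                            2 * k * S * t * ((a * b) * (i * t + k * 2))
    lemma = solve-∀
    product : ∀ i → i * (3 + i) + 2 ≡ (1 + i) * (2 + i)
    product = solve-∀
    lemma′ : ∀ k S t R → 2 * k * S * t * (R * S) ≡ 2 * R * (k * S * (S * t))
    lemma′ = solve-∀

  lnGainSum : ℕ → ℚ
  lnGainSum zero    = lnGain 0
  lnGainSum (suc m) = lnGainSum m ℚ.+ lnGain (suc m)

  lnApprox-step : ∀ m → lnApprox (suc i) m ℚ.+ lnGainSum m ℚ.≤ lnApprox (suc (suc i)) m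
  lnApprox-step zero    = lnTerm-step 0
  lnApprox-step (suc m) = begin
    (lnApprox (suc i) m ℚ.+ lnTerm (suc i) (suc m)) ℚ.+ (lnGainSum m ℚ.+ lnGain (suc m))
      ≡⟨ interchange (lnApprox (suc i) m) (lnTerm (suc i) (suc m)) (lnGainSum m) (lnGain (suc m)) ⟩
    (lnApprox (suc i) m ℚ.+ lnGainSum m) ℚ.+ (lnTerm (suc i) (suc m) ℚ.+ lnGain (suc m))
      ≤⟨ ℚ.+-mono-≤ (lnApprox-step m) (lnTerm-step (suc m)) ⟩
    lnApprox (suc (suc i)) m ℚ.+ lnTerm (suc (suc i)) (suc m) ∎
    where
    open ℚ.≤-Reasoning

  -- tail e = (z′ − z) · 2 zᵉ / (1 − z²), the sum of the geometric series starting from zᵉ.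
  tail : ℕ → ℚ
  tail e = _/_ (+ (i ^ e * s)) (r * t * s ^ e) {{r*t*s^≢0 e}}

  -- Splitting off the first term of the geometric series; the two sides are in fact equal.
  tail-step : ∀ j → tail (2 * j) ℚ.≤ lnGain j ℚ.+ tail (2 * suc j)
  tail-step j = subst (λ e → tail κ ℚ.≤ lnGain j ℚ.+ tail e) (sym (*-suc 2 j))
    (/-≤-sum (4 * i ^ κ) (s ^ suc κ * t) (i ^ (2 + κ) * s) (r * t * s ^ (2 + κ)) (i ^ κ * s) (r * t * s ^ κ)
      {{s^*t≢0 (suc κ)}} {{r*t*s^≢0 (2 + κ)}} {{r*t*s^≢0 κ}}
      (≤-reflexive (lemma i (i ^ κ) (s ^ κ))))
    where
    κ = 2 * j
    lemma : ∀ i a b → a * (2 + i) * ((2 + i) * b * (3 + i) * ((1 + i) * (3 + i) * ((2 + i) * ((2 + i) * b)))) ≡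
      (4 * a * ((1 + i) * (3 + i) * ((2 + i) * ((2 + i) * b))) + i * (i * a) * (2 + i) * ((2 + i) * b * (3 + i)))
        * ((1 + i) * (3 + i) * b)
    lemma = solve-∀

  tail-≤-lnGainSum : ∀ m → tail 0 ℚ.≤ lnGainSum m ℚ.+ tail (2 * suc m)
  tail-≤-lnGainSum zero    = tail-step 0
  tail-≤-lnGainSum (suc m) = begin
    tail 0                                                           ≤⟨ tail-≤-lnGainSum m ⟩
    lnGainSum m ℚ.+ tail (2 * suc m)                                 ≤⟨ ℚ.+-monoʳ-≤ (lnGainSum m) (tail-step (suc m)) ⟩
    lnGainSum m ℚ.+ (lnGain (suc m) ℚ.+ tail (2 * suc (suc m)))      ≡⟨ ℚ.+-assoc (lnGainSum m) _ _ ⟨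
    lnGainSum (suc m) ℚ.+ tail (2 * suc (suc m))                     ∎
    where open ℚ.≤-Reasoning

  -- The whole series sums to `s / (r * t)`, which equals `1 / s + δ` because `r * t + 1 = s * s`.
  -- The surplus `δ` pays for the tail cut off after index `m`.
  1/[2+i]≤lnGainSum : ∀ m → i * (s * s) ≤ m → + 1 / s ℚ.≤ lnGainSum m
  1/[2+i]≤lnGainSum m iss≤m = ℚ-+-cancelʳ-≤ δ (begin
    (+ 1 / s) ℚ.+ δ                          ≤⟨ /-sum-≤ 1 s 1 (r * s * t) (1 * s) (r * t * 1) {{_}} {{_}} {{_}} (≤-reflexive (split i)) ⟩
    tail 0                                   ≤⟨ tail-≤-lnGainSum m ⟩
    lnGainSum m ℚ.+ tail (2 * suc m)         ≤⟨ ℚ.+-monoʳ-≤ (lnGainSum m) tail≤δ ⟩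
    lnGainSum m ℚ.+ δ                        ∎)
    where
    open ℚ.≤-Reasoning
    δ = + 1 / (r * s * t)
    split : ∀ i → (1 * ((1 + i) * (2 + i) * (3 + i)) + 1 * (2 + i)) * ((1 + i) * (3 + i) * 1) ≡
                  1 * (2 + i) * ((2 + i) * ((1 + i) * (2 + i) * (3 + i)))
    split = solve-∀
    tail≤δ : tail (2 * suc m) ℚ.≤ δ
    tail≤δ = subst (λ e → tail e ℚ.≤ δ) (sym (*-suc 2 m))
      (/-≤ (i ^ e * s) (r * t * s ^ e) 1 (r * s * t) {{r*t*s^≢0 e}} {{_}}
        (≤-trans (≤-reflexive (lemma (i ^ e) r s t))
          (≤-trans (*-monoʳ-≤ (r * t) (geometric-decay i m iss≤m)) (≤-reflexive (sym (*-identityˡ _))))))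
      where
      e = 2 + 2 * m
      lemma : ∀ x r s t → x * s * (r * s * t) ≡ r * t * (s * s * x)
      lemma = solve-∀

-- Harmonic numbers against the logarithm

0≤lnTerm : ∀ n j → 0ℚ ℚ.≤ lnTerm n j
0≤lnTerm n j = /-≤ 0 1 (2 * (n ∸ 1) ^ k) (k * suc n ^ k) {{_}} {{k*n^k≢0 n j}} z≤n
  where k = suc (2 * j)

0≤lnApprox : ∀ n m → 0ℚ ℚ.≤ lnApprox n m
0≤lnApprox n zero    = 0≤lnTerm n 0
0≤lnApprox n (suc m) = ℚ.+-mono-≤ (0≤lnApprox n m) (0≤lnTerm n (suc m))

harmonic : ℕ → ℚ
harmonic N = _/_ (+ harm N) (N !) {{N !≢0}}

harmonic-suc-≤ : ∀ N → harmonic (suc N) ℚ.≤ harmonic N ℚ.+ (+ 1 / suc N)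
harmonic-suc-≤ N = /-≤-sum (harm N) (N !) 1 (suc N) (harm (suc N)) (suc N !) {{N !≢0}} {{_}} {{suc N !≢0}}
  (≤-reflexive (lemma (suc N) (harm N) (N !)))
  where
  lemma : ∀ s h f → (s * h + f) * (f * s) ≡ (h * s + 1 * f) * (s * f)
  lemma = solve-∀

harmonic-≤-suc : ∀ N → harmonic N ℚ.≤ harmonic (suc N)
harmonic-≤-suc N = /-≤ (harm N) (N !) (harm (suc N)) (suc N !) {{N !≢0}} {{suc N !≢0}}
  (≤-trans (m≤m+n _ (N ! * N !)) (≤-reflexive (lemma (suc N) (harm N) (N !))))
  where
  lemma : ∀ s h f → h * (s * f) + f * f ≡ (s * h + f) * f
  lemma = solve-∀

-- Induction on `i` at a fixed truncation level `m`: each new term `1 / (i + 2)` is covered by the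
-- gain of the truncated logarithm. The threshold on `m` increases with `i`, so it holds at all
-- earlier stages.
harmonic-≤-1+lnApprox : ∀ m i → i * ((2 + i) * (2 + i)) ≤ m →
  harmonic (suc i) ℚ.≤ 1ℚ ℚ.+ lnApprox (suc i) m
harmonic-≤-1+lnApprox m zero    _  = ℚ.+-monoʳ-≤ 1ℚ (0≤lnApprox 1 m)
harmonic-≤-1+lnApprox m (suc i) le = begin
  harmonic (2 + i)                           ≤⟨ harmonic-suc-≤ (suc i) ⟩
  harmonic (suc i) ℚ.+ (+ 1 / (2 + i))       ≤⟨ ℚ.+-mono-≤ (harmonic-≤-1+lnApprox m i le′) (1/[2+i]≤lnGainSum i m le′) ⟩
  (1ℚ ℚ.+ lnApprox (suc i) m) ℚ.+ lnGainSum i m          ≡⟨ ℚ.+-assoc 1ℚ (lnApprox (suc i) m) (lnGainSum i m) ⟩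
  1ℚ ℚ.+ (lnApprox (suc i) m ℚ.+ lnGainSum i m)          ≤⟨ ℚ.+-monoʳ-≤ 1ℚ (lnApprox-step i m) ⟩
  1ℚ ℚ.+ lnApprox (2 + i) m                              ∎
  where
  open ℚ.≤-Reasoning
  le′ : i * ((2 + i) * (2 + i)) ≤ m
  le′ = ≤-trans (*-mono-≤ (n≤1+n i) (*-mono-≤ (n≤1+n (2 + i)) (n≤1+n (2 + i)))) le

eFraction : ℕ → ℚ
eFraction m = _/_ (+ eNum m) (m !) {{m !≢0}}

eApprox≡ : ∀ m → eApprox m ≡ eFraction m
eApprox≡ zero    = refl
eApprox≡ (suc m) = trans (cong (ℚ._+ (+ 1 / (suc m !))) (eApprox≡ m)) (ℚ.≤-antisym
  (/-sum-≤ (eNum m) (m !) 1 (suc m !) (eNum (suc m)) (suc m !) (≤-reflexive eq))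
  (/-≤-sum (eNum m) (m !) 1 (suc m !) (eNum (suc m)) (suc m !) (≤-reflexive (sym eq))))
  where
  instance
    m!≢0 : NonZero (m !)
    m!≢0 = m !≢0
    [1+m]!≢0 : NonZero (suc m !)
    [1+m]!≢0 = suc m !≢0
  lemma : ∀ s e f → (e * (s * f) + 1 * f) * (s * f) ≡ (s * e + 1) * (f * (s * f))
  lemma = solve-∀
  eq = lemma (suc m) (eNum m) (m !)

-- The chain `e H_N ≤ e (ln n + 1) ≤ k` for `n = N + 1`, with both series truncated at `m` and
-- denominators cleared.
eNum*harm≤ : ∀ N k m → N * ((2 + N) * (2 + N)) ≤ m → L (suc N) m ℚ.≤ + k / 1 →
  eNum m * harm N ≤ k * (m ! * N !)
eNum*harm≤ N k m large L≤k = subst (_≤ k * (m ! * N !)) (*-identityʳ _)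
  (/-≤⁻¹ (eNum m * harm N) (m ! * N !) k 1 {{m*n≢0 (m !) (N !)}} (begin
    _/_ (+ (eNum m * harm N)) (m ! * N !) {{m*n≢0 (m !) (N !)}}   ≡⟨ /-* (eNum m) (m !) (harm N) (N !) ⟨
    eFraction m ℚ.* harmonic N
      ≤⟨ ℚ.*-monoˡ-≤-nonNeg (eFraction m) {{ℚ.normalize-nonNeg (eNum m) (m !)}}
           (ℚ.≤-trans (harmonic-≤-suc N) (harmonic-≤-1+lnApprox m N large)) ⟩
    eFraction m ℚ.* (1ℚ ℚ.+ lnApprox (suc N) m)                   ≡⟨ cong (ℚ._* (1ℚ ℚ.+ lnApprox (suc N) m)) (eApprox≡ m) ⟨
    L (suc N) m                                                   ≤⟨ L≤k ⟩
    + k / 1                                                       ∎))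
  where
  open ℚ.≤-Reasoning
  instance
    m!≢0 : NonZero (m !)
    m!≢0 = m !≢0
    N!≢0 : NonZero (N !)
    N!≢0 = N !≢0

-- The choice x = k / H_N and the final estimate

rising≡*rising₁ : ∀ A B N → rising A B (suc N) ≡ A * rising₁ A B N
rising≡*rising₁ A B zero    = lemma A
  where
  lemma : ∀ A → 1 * (A + 0) ≡ A * 1
  lemma = solve-∀
rising≡*rising₁ A B (suc N) =
  trans (cong (_* (A + suc N * B)) (rising≡*rising₁ A B N)) (*-assoc A (rising₁ A B N) _)

1≤harm : ∀ {N} → 1 ≤ N → 1 ≤ harm N
1≤harm {suc N} _ = ≤-trans (1≤n! N) (m≤n+m (N !) (suc N * harm N))

-- With `W = harm N` and `x = k * N ! / W`, this says `(1 + 1 / W) ^ W ≤ x` for `W > 0`: the left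
-- side is at most e, and `e H_N ≤ k`.
harm-bound : ∀ N k → UpperEL (suc N) k →
  (harm N + 1) ^ harm N * harm N ≤ k * N ! * harm N ^ harm N
harm-bound N k upper = *-cancelˡ-≤ (m !) {{m !≢0}} (begin
  m ! * ((W + 1) ^ W * W)      ≡⟨ *-assoc (m !) ((W + 1) ^ W) W ⟨
  m ! * (W + 1) ^ W * W        ≤⟨ *-monoˡ-≤ W ([1+1/W]^W≤e W d) ⟩
  W ^ W * eNum m * W           ≡⟨ *-assoc (W ^ W) (eNum m) W ⟩
  W ^ W * (eNum m * W)         ≤⟨ *-monoʳ-≤ (W ^ W) (eNum*harm≤ N k m (m≤m+n d W) (upper m)) ⟩
  W ^ W * (k * (m ! * N !))    ≡⟨ lemma (W ^ W) k (m !) (N !) ⟩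
  m ! * (k * N ! * W ^ W)      ∎)
  where
  open ≤-Reasoning
  W = harm N
  -- The threshold of the logarithm estimate; adding `W` also reaches the degree needed for e.
  d = N * ((2 + N) * (2 + N))
  m = d + W
  lemma : ∀ u k f g → u * (k * (f * g)) ≡ f * (k * g * u)
  lemma = solve-∀

-- In terms of `x` the product of all `1 + x / j` is at most `(1 + 1 / W) ^ (k * W)`, hence at most
-- `x ^ k` by the `k`-th power of `key`.
rising₁-≤ : ∀ N k → 1 ≤ harm N → (harm N + 1) ^ harm N * harm N ≤ k * N ! * harm N ^ harm N →
  rising₁ (k * N !) (harm N) N * harm N ^ k ≤ N ! * ((k * N !) ^ k * harm N ^ N)
rising₁-≤ N k W≥1 key = *-cancelˡ-≤ (W ^ (k * W)) {{m^n≢0 W (k * W) {{>-nonZero W≥1}}}} (begin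
  W ^ (k * W) * (rising₁ A W N * W ^ k)        ≡⟨ lemma (W ^ (k * W)) (rising₁ A W N) (W ^ k) ⟩
  rising₁ A W N * W ^ (k * W) * W ^ k          ≤⟨ *-monoˡ-≤ (W ^ k) bound ⟩
  N ! * ((W + 1) ^ (k * W) * W ^ N) * W ^ k    ≡⟨ lemma′ (N !) ((W + 1) ^ (k * W)) (W ^ N) (W ^ k) ⟩
  N ! * W ^ N * ((W + 1) ^ (k * W) * W ^ k)    ≤⟨ *-monoʳ-≤ (N ! * W ^ N) key^k ⟩
  N ! * W ^ N * (A ^ k * W ^ (k * W))          ≡⟨ lemma″ (N !) (W ^ N) (A ^ k) (W ^ (k * W)) ⟩
  W ^ (k * W) * (N ! * (A ^ k * W ^ N))        ∎)
  where
  open ≤-Reasoning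
  W = harm N
  A = k * N !
  bound : rising₁ A W N * W ^ (k * W) ≤ N ! * ((W + 1) ^ (k * W) * W ^ N)
  bound = subst₂ (λ f h → rising₁ (k * f) W N * W ^ (k * h) ≤ N ! * ((W + 1) ^ (k * h) * W ^ N))
    (*-identityˡ (N !)) (*-identityˡ W) (rising₁-bound k W N 1)
  pow : ∀ x → (x ^ W) ^ k ≡ x ^ (k * W)
  pow x = trans (^-*-assoc x W k) (cong (x ^_) (*-comm W k))
  key^k : (W + 1) ^ (k * W) * W ^ k ≤ A ^ k * W ^ (k * W)
  key^k = begin
    (W + 1) ^ (k * W) * W ^ k    ≡⟨ cong (_* W ^ k) (pow (W + 1)) ⟨
    ((W + 1) ^ W) ^ k * W ^ k    ≡⟨ ^-distribʳ-* k ((W + 1) ^ W) W ⟨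
    ((W + 1) ^ W * W) ^ k        ≤⟨ ^-monoˡ-≤ k key ⟩
    (A * W ^ W) ^ k              ≡⟨ ^-distribʳ-* k A (W ^ W) ⟩
    A ^ k * (W ^ W) ^ k          ≡⟨ cong (A ^ k *_) (pow W) ⟩
    A ^ k * W ^ (k * W)          ∎
  lemma : ∀ u r v → u * (r * v) ≡ r * u * v
  lemma = solve-∀
  lemma′ : ∀ f x y z → f * (x * y) * z ≡ f * y * (x * z)
  lemma′ = solve-∀
  lemma″ : ∀ f y a u → f * y * (a * u) ≡ u * (f * (a * y))
  lemma″ = solve-∀

-- This is `x ≥ 1`, read off from `1 ≤ (1 + 1 / W) ^ W ≤ x`.
harm≤ : ∀ N k → (harm N + 1) ^ harm N * harm N ≤ k * N ! * harm N ^ harm N → harm N ≤ k * N !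
harm≤ N k key = *-cancelˡ-≤ ((W + 1) ^ W) {{m^n≢0 (W + 1) W {{>-nonZero (m≤n+m 1 W)}}}} (begin
  (W + 1) ^ W * W           ≤⟨ key ⟩
  k * N ! * W ^ W           ≤⟨ *-monoʳ-≤ (k * N !) (^-monoˡ-≤ W (m≤m+n W 1)) ⟩
  k * N ! * (W + 1) ^ W     ≡⟨ *-comm (k * N !) _ ⟩
  (W + 1) ^ W * (k * N !)   ∎)
  where
  open ≤-Reasoning
  W = harm N

few-cycles-bound : ∀ {N} k A B → 1 ≤ N → 1 ≤ B → B ≤ A → (q p : Fin (suc N) → ℕ) → (∀ i → q i + p i ≡ suc N) →
  suc N ! * sum (λ i → 1 * (A ^ q i * B ^ p i)) ≤ sum {suc N} (λ _ → 1) * rising A B (suc N) →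
  rising₁ A B N * B ^ k ≤ N ! * (A ^ k * B ^ N) →
  ∀ i → q i ≤ k
few-cycles-bound {N} k A B N≥1 B≥1 B≤A q p q+p≡ average rising≤ i with q i ≤? k
... | yes q≤k = q≤k
... | no  q≰k = contradiction (begin-strict
  A ^ suc k * B ^ N       ≤⟨ term-large ⟩
  f i * B ^ k             <⟨ *-monoˡ-< (B ^ k) {{m^n≢0 B k}} term<sum ⟩
  sum f * B ^ k           ≤⟨ sum-small ⟩
  A ^ suc k * B ^ N       ∎) (<-irrefl refl)
  where
  open ≤-Reasoning
  instance
    B≢0 : NonZero B
    B≢0 = >-nonZero B≥1
    A≢0 : NonZero A
    A≢0 = >-nonZero (≤-trans B≥1 B≤A)
  f : Fin (suc N) → ℕ
  f i = 1 * (A ^ q i * B ^ p i)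

  f≥1 : ∀ i → 1 ≤ f i
  f≥1 i = *-mono-≤ (≤-refl {1}) (*-mono-≤ (m^n>0 A (q i)) (m^n>0 B (p i)))

  -- The only strict link of the contradiction: besides the term at `i` there are `N ≥ 1` further
  -- terms, all positive.
  term<sum : f i < sum f
  term<sum = ≤-trans (≤-reflexive (+-comm 1 (f i))) (≤-trans (+-monoʳ-≤ (f i) N≥1) (+-≤-sum f f≥1 i))

  e = q i ∸ suc k
  q≡ : suc k + e ≡ q i
  q≡ = m+[n∸m]≡n (≰⇒> q≰k)
  N≡ : N ≡ e + p i + k
  N≡ = suc-injective (trans (sym (q+p≡ i)) (trans (cong (_+ p i) (sym q≡)) (lemma k e (p i))))
    where
    lemma : ∀ k e p → suc k + e + p ≡ suc (e + p + k)
    lemma = solve-∀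

  term-large : A ^ suc k * B ^ N ≤ f i * B ^ k
  term-large = begin
    A ^ suc k * B ^ N                             ≡⟨ cong (λ x → A ^ suc k * B ^ x) N≡ ⟩
    A ^ suc k * B ^ (e + p i + k)                 ≡⟨ cong (A ^ suc k *_) (^-distribˡ-+-* B (e + p i) k) ⟩
    A ^ suc k * (B ^ (e + p i) * B ^ k)           ≡⟨ cong (λ x → A ^ suc k * (x * B ^ k)) (^-distribˡ-+-* B e (p i)) ⟩
    -- The `e` cycles in excess of `k + 1` only enlarge the term, because `B ≤ A`.
    A ^ suc k * (B ^ e * B ^ p i * B ^ k)         ≤⟨ *-monoʳ-≤ (A ^ suc k) (*-monoˡ-≤ (B ^ k) (*-monoˡ-≤ (B ^ p i) (^-monoˡ-≤ e B≤A))) ⟩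
    A ^ suc k * (A ^ e * B ^ p i * B ^ k)         ≡⟨ lemma (A ^ suc k) (A ^ e) (B ^ p i) (B ^ k) ⟩
    1 * (A ^ suc k * A ^ e * B ^ p i) * B ^ k     ≡⟨ cong (λ x → 1 * (x * B ^ p i) * B ^ k) (^-distribˡ-+-* A (suc k) e) ⟨
    1 * (A ^ (suc k + e) * B ^ p i) * B ^ k       ≡⟨ cong (λ x → 1 * (A ^ x * B ^ p i) * B ^ k) q≡ ⟩
    f i * B ^ k                                   ∎
    where
    lemma : ∀ x y z u → x * (y * z * u) ≡ 1 * (x * y * z) * u
    lemma = solve-∀

  sum-small : sum f * B ^ k ≤ A ^ suc k * B ^ N
  sum-small = *-cancelˡ-≤ (suc N !) {{suc N !≢0}} (begin
    suc N ! * (sum f * B ^ k)                         ≡⟨ *-assoc (suc N !) (sum f) (B ^ k) ⟨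
    suc N ! * sum f * B ^ k                           ≤⟨ *-monoˡ-≤ (B ^ k) average ⟩
    sum {suc N} (λ _ → 1) * rising A B (suc N) * B ^ k
      ≡⟨ cong₂ (λ x y → x * y * B ^ k) (sum-const (suc N) 1) (rising≡*rising₁ A B N) ⟩
    suc N * 1 * (A * rising₁ A B N) * B ^ k           ≡⟨ lemma (suc N) A (rising₁ A B N) (B ^ k) ⟩
    suc N * A * (rising₁ A B N * B ^ k)               ≤⟨ *-monoʳ-≤ (suc N * A) rising≤ ⟩
    suc N * A * (N ! * (A ^ k * B ^ N))               ≡⟨ lemma′ (suc N) A (N !) (A ^ k) (B ^ N) ⟩
    suc N * N ! * (A * A ^ k * B ^ N)                 ∎)
    where
    lemma : ∀ s A r u → s * 1 * (A * r) * u ≡ s * A * (r * u)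
    lemma = solve-∀
    lemma′ : ∀ s A f u v → s * A * (f * (u * v)) ≡ s * f * (A * u * v)
    lemma′ = solve-∀

theorem3p10 : (n : ℕ) → 1 < n → (k : ℕ) → IsCeilEL n k → tAtLeast n (n ∸ k)
theorem3p10 (suc N) (s≤s N≥1) k (upper , _) =
  let key = harm-bound N k upper
      -- Unit weights and the powers of the cycle as `τ`: the permutations counted are then exactly
      -- those of `coset π`.
      π , q , p , q+p≡ , cyc≤q , average = ∃-few-cycles (k * N !) (harm N) rotation (λ _ → 1)
      q≤k = few-cycles-bound k (k * N !) (harm N) N≥1 (1≤harm N≥1) (harm≤ N k key) q p q+p≡ average
              (rising₁-≤ N k (1≤harm N≥1) key)
  in π , λ i → ∸-monoʳ-≤ (suc N) (≤-trans (cyc≤q i) (q≤k i))
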